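{- Let $\mathcal K$ be an abstract Krivine structure, $\mathsf E=\mathsf S(\mathsf K(\mathsf S\mathsf K\mathsf K))$, and for $P\subseteq\Pi$ put $\eta P=\{\mathsf E\mathsf E\}^\perp\ast_\bullet{}^\perp P$. Then for all $P\subseteq\Pi$ and $L\subseteq\Lambda$: $$P\ast_\bullet L\subseteq P\ast L\subseteq P\ast_\perp L\subseteq P\,\clubsuit\,L\subseteq \eta P\ast_\bullet L\subseteq\eta P\ast L\subseteq\eta P\ast_\perp L.$$
   Context: An abstract Krivine structure $\mathcal K$ consists of sets $\Lambda$ (terms), $\Pi$ (stacks), a relation $\perp\subseteq\Lambda\times\Pi$ (write $t\perp\pi$), a map $\mathrm{push}:\Lambda\times\Pi\to\Pi$ written $t\cdot\pi$ (associating to the right), a map $\mathrm{app}:\Lambda\times\Lambda\to\Lambda$ written $ts$ (associating to the left), a subset $\mathrm{QP}\subseteq\Lambda$ closed under application, and $\mathsf K,\mathsf S\in\mathrm{QP}$ such that for all $t,s,u\in\Lambda$, $\pi\in\Pi$: (a) $t\perp s\cdot\pi$ implies $ts\perp\pi$; (b) $t\perp\pi$ implies $\mathsf K\perp t\cdot s\cdot\pi$; (c) $tu(su)\perp\pi$ implies $\mathsf S\perp t\cdot s\cdot u\cdot\pi$. Polars: $L^\perp=\{\pi:\forall t\in L,\ t\perp\pi\}$, ${}^\perp P=\{t:\forall\pi\in P,\ t\perp\pi\}$; $\overline P=({}^\perp P)^\perp$. Define $P\ast L=\{\pi: t\cdot\pi\in P\ \forall t\in L\}$, $P\ast_\perp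 L=\overline{P\ast L}$, $P\ast_\bullet L=\{\pi: t\cdot\pi'\in P\ \forall t\in L,\ \pi'\in\overline{\{\pi\}}\}$, $P\,\clubsuit\,L=(\{t\ell:t\in{}^\perp P,\ \ell\in L\})^\perp$. -}

module Defs where

open import Level using (Level; _⊔_; suc)
open import Data.Product using (_×_; ∃₂)
open import Relation.Binary.Core using (REL)
open import Relation.Binary.PropositionalEquality using (_≡_)
open import Relation.Unary using (Pred; _∈_; ｛_｝)

-- Pushing t onto π is t · π; the application usually written ts is t ⋆ s.
-- Subsets are predicates, of arbitrary universe level.
record AbstractKrivineStructure (a b r q : Level) : Set (suc (a ⊔ b ⊔ r ⊔ q)) where
  infixl 9 _⋆_
  infixr 8 _·_
  infix  4 _⊥_
  field
    Λ   : Set a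
    Π   : Set b
    _⊥_ : REL Λ Π r
    _·_ : Λ → Π → Π
    _⋆_ : Λ → Λ → Λ
    QP  : Pred Λ q
    QP-closed : ∀ {t s} → t ∈ QP → s ∈ QP → t ⋆ s ∈ QP
    K S : Λ
    K∈QP : K ∈ QP
    S∈QP : S ∈ QP
    ⊥-app : ∀ {t s π} → t ⊥ s · π → t ⋆ s ⊥ π
    ⊥-K   : ∀ {t s π} → t ⊥ π → K ⊥ t · s · π
    ⊥-S   : ∀ {t s u π} → t ⋆ u ⋆ (s ⋆ u) ⊥ π → S ⊥ t · s · u · π

module Operations {a b r q} (𝒦 : AbstractKrivineStructure a b r q) where
  open AbstractKrivineStructure 𝒦

  private
    variable
      ℓ ℓ₁ ℓ₂ : Level

  infix  10 _^⊥ ⊥^_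
  infixl 7 _∗_ _∗⊥_ _∗•_ _♣_

  _^⊥ : Pred Λ ℓ → Pred Π (a ⊔ r ⊔ ℓ)
  (L ^⊥) π = ∀ t → t ∈ L → t ⊥ π

  ⊥^_ : Pred Π ℓ → Pred Λ (b ⊔ r ⊔ ℓ)
  (⊥^ P) t = ∀ π → π ∈ P → t ⊥ π

  closure : Pred Π ℓ → Pred Π (a ⊔ b ⊔ r ⊔ ℓ)
  closure P = (⊥^ P) ^⊥

  _∗_ : Pred Π ℓ₁ → Pred Λ ℓ₂ → Pred Π (a ⊔ ℓ₁ ⊔ ℓ₂)
  (P ∗ L) π = ∀ t → t ∈ L → t · π ∈ P

  _∗⊥_ : Pred Π ℓ₁ → Pred Λ ℓ₂ → Pred Π (a ⊔ b ⊔ r ⊔ ℓ₁ ⊔ ℓ₂)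
  P ∗⊥ L = closure (P ∗ L)

  _∗•_ : Pred Π ℓ₁ → Pred Λ ℓ₂ → Pred Π (a ⊔ b ⊔ r ⊔ ℓ₁ ⊔ ℓ₂)
  (P ∗• L) π = ∀ t π′ → t ∈ L → π′ ∈ closure ｛ π ｝ → t · π′ ∈ P

  _♣_ : Pred Π ℓ₁ → Pred Λ ℓ₂ → Pred Π (a ⊔ b ⊔ r ⊔ ℓ₁ ⊔ ℓ₂)
  P ♣ L = (λ u → ∃₂ λ t l → t ∈ ⊥^ P × l ∈ L × u ≡ t ⋆ l) ^⊥

  E : Λ
  E = S ⋆ (K ⋆ (S ⋆ K ⋆ K))

  η : Pred Π ℓ → Pred Π (a ⊔ b ⊔ r ⊔ ℓ)
  η P = ｛ E ⋆ E ｝ ^⊥ ∗• ⊥^ P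

{-# OPTIONS --safe #-}
-- E realises application, i.e. t ⋆ s ⊥ π implies E ⋆ t ⊥ s · π, a converse of
-- ⊥-app. Used with t = E it also gives that E ⋆ t ⊥ ρ implies E ⋆ E ⊥ t · ρ.
-- The detour through E ⋆ t, a single term, is what allows ρ to range over the
-- closure of the stack s · π in the definition of η.
module Submission where

open import Data.Product using (_×_; _,_)
open import Relation.Binary.PropositionalEquality using (refl)
open import Relation.Unary using (Pred; _∈_; _⊆_; ｛_｝)
open import Defs

module _ {a b r q} (𝒦 : AbstractKrivineStructure a b r q) where
  open AbstractKrivineStructure 𝒦
  open Operations 𝒦

  closure-extensive : ∀ {ℓ} (P : Pred Π ℓ) → P ⊆ closure P
  closure-extensive P π∈P t t∈⊥P = t∈⊥P _ π∈P

  -- Double polars add only stacks orthogonal to every term that is orthogonal to `π`. This absorbs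
  -- the closures in `∗•`.
  ⊥-closure-singleton : ∀ {t π ρ} → ρ ∈ closure ｛ π ｝ → t ⊥ π → t ⊥ ρ
  ⊥-closure-singleton ρ∈ t⊥π = ρ∈ _ λ { _ refl → t⊥π }

  ⊥-I : ∀ {t π} → t ⊥ π → S ⋆ K ⋆ K ⊥ t · π
  ⊥-I t⊥π = ⊥-app (⊥-app (⊥-S (⊥-app (⊥-app (⊥-K t⊥π)))))

  ⊥-E : ∀ {t s π} → t ⋆ s ⊥ π → E ⋆ t ⊥ s · π
  -- From the inside out, with I = `S ⋆ K ⋆ K`: `t ⋆ s`, then I (t s), then K I s (t s), as `⊥-S`
  -- requires.
  ⊥-E ts⊥π = ⊥-app (⊥-app (⊥-S (⊥-app (⊥-app (⊥-app (⊥-K (⊥-I ts⊥π)))))))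

  module _ {ℓ₁ ℓ₂} (P : Pred Π ℓ₁) (L : Pred Λ ℓ₂) where

    ∗•⊆∗ : P ∗• L ⊆ P ∗ L
    ∗•⊆∗ π∈ l l∈L = π∈ l _ l∈L (closure-extensive ｛ _ ｝ refl)

    -- Every `t ⋆ l` lies in the left polar of `P ∗ L`.
    ∗⊥⊆♣ : P ∗⊥ L ⊆ P ♣ L
    ∗⊥⊆♣ π∈ _ (t , l , t∈⊥P , l∈L , refl) =
      π∈ (t ⋆ l) λ ρ ρ∈P∗L → ⊥-app (t∈⊥P (l · ρ) (ρ∈P∗L l l∈L))

    ♣⊆η∗• : P ♣ L ⊆ η P ∗• L
    ♣⊆η∗• π∈ l π′ l∈L π′∈ t ρ t∈⊥P ρ∈ _ refl =
      -- In order: `t ⋆ l ⊥ π`, `t ⋆ l ⊥ π′`, `E ⋆ t ⊥ l · π′`, `E ⋆ t ⊥ ρ`, `E ⋆ E ⊥ t · ρ`.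
      ⊥-E (⊥-closure-singleton ρ∈ (⊥-E (⊥-closure-singleton π′∈ tl⊥π)))
      where tl⊥π = π∈ (t ⋆ l) (t , l , t∈⊥P , l∈L , refl)

mainTheorem6 : ∀ {a b r q ℓ₁ ℓ₂} (𝒦 : AbstractKrivineStructure a b r q) →
    let open AbstractKrivineStructure 𝒦
        open Operations 𝒦
    in (P : Pred Π ℓ₁) (L : Pred Λ ℓ₂) →
       (P ∗• L ⊆ P ∗ L)
     × (P ∗ L ⊆ P ∗⊥ L)
     × (P ∗⊥ L ⊆ P ♣ L)
     × (P ♣ L ⊆ η P ∗• L)
     × (η P ∗• L ⊆ η P ∗ L)
     × (η P ∗ L ⊆ η P ∗⊥ L)
mainTheorem6 𝒦 P L =
    ∗•⊆∗ 𝒦 P L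
  , closure-extensive 𝒦 (P ∗ L)
  , ∗⊥⊆♣ 𝒦 P L
  , ♣⊆η∗• 𝒦 P L
  , ∗•⊆∗ 𝒦 (η P) L
  , closure-extensive 𝒦 (η P ∗ L)
  where open Operations 𝒦
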